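{- Let $n\geq 1$ be an integer. Then the Munarini graph $M_{n,1}$ is isomorphic to the Fibonacci cube $\Gamma_{n-1}$, and the Munarini graph $M_{n,2}$ is isomorphic to the Pell graph $\Pi_n$.
   Context: For integers $k\geq 1$, $n\geq 0$, a $k$-generalized Pell string of length $n$ is a word of length $n$ over the alphabet $\{0,1,\ldots,k\}$ in which every maximal run of the character $k$ has even length (equivalently, a concatenation of letters from $\{0,1,\ldots,k-1,kk\}$). Let $\mathcal{F}_{n,k}$ be the set of these strings (for $n=0$ it contains only the empty string). The Munarini graph $M_{n,k}$ is the simple graph with vertex set $\mathcal{F}_{n,k}$ in which two vertices are adjacent if one of them can be obtained from the other either by replacing one occurrence of $0$ with some $i\in\{1,\ldots,k-1\}$, or by replacing one substring $00$ (two consecutive positions) with $kk$ (both replacements may be read in either direction, and both strings must be in $\mathcal{F}_{n,k}$). The Fibonacci cube $\Gamma_n$ is the subgraph of the hypercube $Q_n$ (vertex set $\{0,1\}^n$, two strings adjacent iff they differ in exactly one coordinate) induced by the binary strings of length $n$ with no two consecutive $1$s; $\Gamma_0=K_1$. The Pell graph $\Pi_n$ has as vertices the words of length $n$ over $\{0,1,2\}$ in which every maximal run of $2$s has even length (Pell strings); two vertices are adjacent if one is obtained from the other by replacing one $0$ with $1$ (or vice versa), or by replacing one substring $11$ with $22$ (or vice versa), in such a way that the new string is again a Pell string. -}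

module Defs where

open import Data.Bool using (Bool; true)
open import Data.Fin using (Fin; zero; fromℕ)
open import Data.Fin.Patterns using (0F; 1F; 2F)
import Data.List as List
open import Data.List using (List)
open import Data.List.Relation.Unary.Linked using (Linked)
open import Data.Maybe using (just)
open import Data.Nat using (ℕ; suc; NonZero)
open import Data.Nat.Divisibility using (_∣_)
open import Data.Product using (_×_; _,_; ∃!)
open import Data.Refinement using (Refinement; value)
open import Data.Vec using (Vec; []; _∷_; [_]; _++_; lookup; toList)
open import Data.Vec.Properties using (++-injectiveˡ; ∷-injectiveˡ; ∷-injectiveʳ)
open import Function.Bundles using (_↔_; _⇔_; Inverse)
open import Relation.Binary.Construct.Closure.Symmetric using (SymClosure; fwd; bwd; symmetric)
open import Relation.Binary.PropositionalEquality using (_≡_; _≢_; refl; sym)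
open import Relation.Nullary using (¬_)

record SimpleGraph : Set₁ where
  field
    Vertex : Set
    Adj    : Vertex → Vertex → Set
    adj-sym    : ∀ {x y} → Adj x y → Adj y x
    adj-irrefl : ∀ {x} → ¬ Adj x x

open SimpleGraph public

infix 4 _≅_
record _≅_ (G H : SimpleGraph) : Set where
  field
    bijection : Vertex G ↔ Vertex H
    adjacency : ∀ x y → Adj G x y ⇔ Adj H (Inverse.to bijection x) (Inverse.to bijection y)

-- Membership proofs are irrelevant, so two vertices of the induced subgraph
-- are equal exactly when they are equal as vertices of G.
induced : (G : SimpleGraph) → (Vertex G → Set) → SimpleGraph
induced G P = record
  { Vertex     = Refinement (Vertex G) P
  ; Adj        = λ x y → Adj G (value x) (value y)
  ; adj-sym    = adj-sym G
  ; adj-irrefl = adj-irrefl G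
  }

symGraph : (V : Set) (R : V → V → Set) → (∀ {x} → ¬ R x x) → SimpleGraph
symGraph V R irr = record
  { Vertex     = V
  ; Adj        = SymClosure R
  ; adj-sym    = symmetric R
  ; adj-irrefl = λ { (fwd r) → irr r ; (bwd r) → irr r }
  }

-- Replace x y s t: t arises from s by replacing one occurrence of the
-- substring x (consecutive positions) by y.
data Replace {A : Set} {p : ℕ} (x y : Vec A p) : {n : ℕ} → Vec A n → Vec A n → Set where
  here  : ∀ {m} (v : Vec A m) → Replace x y (x ++ v) (y ++ v)
  there : ∀ {n} {s t : Vec A n} (a : A) → Replace x y s t → Replace x y (a ∷ s) (a ∷ t)

replace-irrefl : ∀ {A : Set} {p n} {x y : Vec A p} {s t : Vec A n} →
                 Replace x y s t → s ≡ t → x ≡ y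
replace-irrefl {x = x} {y} (here v) eq = ++-injectiveˡ x y eq
replace-irrefl (there a r) eq = replace-irrefl r (∷-injectiveʳ eq)

-- Every maximal run of a in w has even length: in a factorisation
-- w = u aᵐ v the block aᵐ is maximal when u does not end, and v does not
-- begin, with a. (The case m = 0 imposes nothing.)
EvenRuns : {A : Set} (a : A) {n : ℕ} → Vec A n → Set
EvenRuns {A} a w =
  ∀ (u : List A) (m : ℕ) (v : List A) →
  toList w ≡ u List.++ List.replicate m a List.++ v →
  List.last u ≢ just a → List.head v ≢ just a →
  2 ∣ m

-- The alphabet {0,…,k} is Fin (suc k); the character k is fromℕ k.
PellString : (k : ℕ) {n : ℕ} → Vec (Fin (suc k)) n → Set
PellString k = EvenRuns (fromℕ k)

data MunariniStep (k : ℕ) {n : ℕ} (s t : Vec (Fin (suc k)) n) : Set where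
  0→i   : (i : Fin (suc k)) → i ≢ zero → i ≢ fromℕ k →
          Replace [ zero ] [ i ] s t → MunariniStep k s t
  00→kk : Replace (zero ∷ zero ∷ []) (fromℕ k ∷ fromℕ k ∷ []) s t → MunariniStep k s t

munariniStep-irrefl : (k : ℕ) .{{_ : NonZero k}} {n : ℕ} {s : Vec (Fin (suc k)) n} →
                      ¬ MunariniStep k s s
munariniStep-irrefl k (0→i i i≢0 _ r) = i≢0 (sym (∷-injectiveˡ (replace-irrefl r refl)))
munariniStep-irrefl (suc k) (00→kk r) with () ← ∷-injectiveˡ (replace-irrefl r refl)

Munarini : (n k : ℕ) .{{_ : NonZero k}} → SimpleGraph
Munarini n k =
  induced (symGraph (Vec (Fin (suc k)) n) (MunariniStep k) (munariniStep-irrefl k)) (PellString k)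

-- true is the bit 1.
Hypercube : ℕ → SimpleGraph
Hypercube n = record
  { Vertex     = Vec Bool n
  ; Adj        = λ s t → ∃! _≡_ λ i → lookup s i ≢ lookup t i
  ; adj-sym    = λ { (i , d , u) → i , (λ e → d (sym e)) , λ d′ → u (λ e → d′ (sym e)) }
  ; adj-irrefl = λ { (i , d , _) → d refl }
  }

NoConsecutive1s : {n : ℕ} → Vec Bool n → Set
NoConsecutive1s s = Linked (λ a b → ¬ (a ≡ true × b ≡ true)) (toList s)

FibonacciCube : ℕ → SimpleGraph
FibonacciCube n = induced (Hypercube n) NoConsecutive1s

data PellStep {n : ℕ} (s t : Vec (Fin 3) n) : Set where
  0→1   : Replace [ 0F ] [ 1F ] s t → PellStep s t
  11→22 : Replace (1F ∷ 1F ∷ []) (2F ∷ 2F ∷ []) s t → PellStep s t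

pellStep-irrefl : {n : ℕ} {s : Vec (Fin 3) n} → ¬ PellStep s s
pellStep-irrefl (0→1 r)   with () ← ∷-injectiveˡ (replace-irrefl r refl)
pellStep-irrefl (11→22 r) with () ← ∷-injectiveˡ (replace-irrefl r refl)

PellGraph : ℕ → SimpleGraph
PellGraph n = induced (symGraph (Vec (Fin 3) n) PellStep pellStep-irrefl) (PellString 2)

{-# OPTIONS --safe #-}
-- A word has even runs of a iff a two-state automaton, which remembers the parity of the
-- current run of a, accepts it; in particular the property is decidable.
-- A word of M(n,1) is a sequence of blocks 0 and 11; recording the state of the automaton after
-- each letter but the last marks the first letter of every block 11, and 00 → 11 flips exactly
-- one mark. The inverse takes sums mod 2 of neighbouring marks.
-- For k = 2, exchanging the letters 0 and 1 turns 0 → 1 around and 00 → 22 into 11 → 22.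
module Submission where

open import Defs
open import Data.Bool using (Bool; true; false; not; _xor_)
import Data.Bool.Properties as Bool
open import Data.Fin using (Fin; zero; suc; _≟_)
open import Data.Fin.Patterns using (0F; 1F; 2F)
open import Data.Fin.Properties using (suc-injective)
import Data.List as List
open import Data.List using (List)
open import Data.List.Relation.Unary.Linked using ([-]; _∷_)
import Data.List.Relation.Unary.Linked as Linked
open import Data.List.Properties using (∷-injective; ++-assoc)
open import Data.Irrelevant using ([_])
open import Data.Maybe using (just)
open import Data.Maybe.Properties using (just-injective)
open import Data.Nat using (ℕ; zero; suc; _*_; _≥_; _∸_)
open import Data.Nat.Divisibility using (_∣_; divides; _∣0; ∣m∣n⇒∣m+n; ∣-refl)
open import Data.Product using (_×_; _,_)
open import Data.Refinement using (_,_; value)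
open import Data.Refinement.Properties using (value-injective)
open import Data.Vec using (Vec; []; _∷_; map; lookup; toList)
open import Data.Vec.Properties using (map-++; map-∘; map-cong; map-id)
open import Data.Vec.Relation.Binary.Pointwise.Extensional using (ext; Pointwise-≡⇒≡)
open import Function.Base using (_∘_)
open import Function.Bundles using (mk↔ₛ′; mk⇔)
open import Relation.Binary.Construct.Closure.Symmetric using (SymClosure; fwd; bwd; gmap)
open import Relation.Binary.Definitions using (DecidableEquality)
open import Relation.Binary.PropositionalEquality using (_≡_; _≢_; refl; sym; trans; cong; subst; subst₂)
open import Relation.Nullary using (Dec; yes; no; contradiction; recompute)
open import Relation.Nullary.Decidable using (map′; decidable-stable)

-- Even runs and the parity automaton.

odd : ℕ → Bool
odd zero    = false
odd (suc m) = not (odd m)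

2∣⇒odd≡false : ∀ {m} → 2 ∣ m → odd m ≡ false
2∣⇒odd≡false (divides q refl) = go q
  where
  go : ∀ q → odd (q * 2) ≡ false
  go zero    = refl
  go (suc q) = trans (Bool.not-involutive _) (go q)

odd≡false⇒2∣ : ∀ m → odd m ≡ false → 2 ∣ m
odd≡false⇒2∣ zero          _  = 2 ∣0
odd≡false⇒2∣ (suc (suc m)) eq =
  ∣m∣n⇒∣m+n ∣-refl (odd≡false⇒2∣ m (trans (sym (Bool.not-involutive _)) eq))

-- EvenRunsAfter a c w: all runs of a are even once w is preceded by a run of a of parity c
-- (true for odd).
data EvenRunsAfter {A : Set} (a : A) : Bool → {n : ℕ} → Vec A n → Set where
  []    : EvenRunsAfter a false []
  run   : ∀ {c n} {w : Vec A n} → EvenRunsAfter a (not c) w → EvenRunsAfter a c (a ∷ w)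
  other : ∀ {b n} {w : Vec A n} → b ≢ a → EvenRunsAfter a false w → EvenRunsAfter a false (b ∷ w)

module _ {A : Set} {a : A} where

  -- Vertices carry their membership proofs irrelevantly; deciding acceptance lets a derivation be
  -- recomputed where a relevant one has to be taken apart.
  evenRunsAfter? : DecidableEquality A → ∀ c {n} (w : Vec A n) → Dec (EvenRunsAfter a c w)
  evenRunsAfter? _≟ᴬ_ false [] = yes []
  evenRunsAfter? _≟ᴬ_ true  [] = no λ ()
  evenRunsAfter? _≟ᴬ_ c (b ∷ w) with b ≟ᴬ a
  ... | yes refl = map′ run (λ { (run e) → e ; (other b≢a _) → contradiction refl b≢a })
                        (evenRunsAfter? _≟ᴬ_ (not c) w)
  evenRunsAfter? _≟ᴬ_ false (b ∷ w) | no b≢a =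
    map′ (other b≢a) (λ { (run _) → contradiction refl b≢a ; (other _ e) → e })
         (evenRunsAfter? _≟ᴬ_ false w)
  evenRunsAfter? _≟ᴬ_ true  (b ∷ w) | no b≢a = no λ { (run _) → b≢a refl }

  evenRunsAfter-map : ∀ {f : A → A} → f a ≡ a → (∀ {b} → f b ≡ a → b ≡ a) →
                      ∀ {c n} {w : Vec A n} → EvenRunsAfter a c w → EvenRunsAfter a c (map f w)
  evenRunsAfter-map fa inv []            = []
  evenRunsAfter-map {f} fa inv {c} (run {w = w} e) =
    subst (λ x → EvenRunsAfter a c (x ∷ map f w)) (sym fa) (run (evenRunsAfter-map fa inv e))
  evenRunsAfter-map fa inv (other b≢a e) = other (b≢a ∘ inv) (evenRunsAfter-map fa inv e)

  -- Each `a` flips the state, and a run can end only in state `false`, so the leading block must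
  -- cancel the parity `c`.
  leadingRun-parity : ∀ {c n} {w : Vec A n} → EvenRunsAfter a c w → ∀ m {v} →
                      toList w ≡ List.replicate m a List.++ v → List.head v ≢ just a → odd m ≡ c
  leadingRun-parity []            zero    eq   v≢a = refl
  leadingRun-parity (run e)       zero    refl v≢a = contradiction refl v≢a
  leadingRun-parity (other _ e)   zero    eq   v≢a = refl
  leadingRun-parity {c} (run e)   (suc m) eq   v≢a with _ , eq′ ← ∷-injective eq =
    trans (cong not (leadingRun-parity e m eq′ v≢a)) (Bool.not-involutive c)
  leadingRun-parity (other b≢a _) (suc m) eq   v≢a with b≡a , _ ← ∷-injective eq =
    contradiction b≡a b≢a

  -- With `u` empty the block continues the run already open and has parity `c`, whence the side
  -- condition. It is vacuous for nonempty `u`, and when `u` gets used up its last letter is not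
  -- `a`, so the state is then `false`.
  innerRun-parity : ∀ {c n} {w : Vec A n} → EvenRunsAfter a c w →
                    ∀ u m {v} → toList w ≡ u List.++ List.replicate m a List.++ v →
                    (u ≡ List.[] → c ≡ false) → List.last u ≢ just a → List.head v ≢ just a →
                    odd m ≡ false
  innerRun-parity e List.[] m eq c≡f _ v≢a = trans (leadingRun-parity e m eq v≢a) (c≡f refl)
  innerRun-parity (run e) (x List.∷ List.[]) m eq _ u≢a v≢a with refl , _ ← ∷-injective eq =
    contradiction refl u≢a
  innerRun-parity (run e) (x List.∷ y List.∷ u) m eq _ u≢a v≢a with _ , eq′ ← ∷-injective eq =
    innerRun-parity e (y List.∷ u) m eq′ (λ ()) u≢a v≢a
  innerRun-parity (other _ e) (x List.∷ List.[]) m eq _ u≢a v≢a with _ , eq′ ← ∷-injective eq =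
    innerRun-parity e List.[] m eq′ (λ _ → refl) (λ ()) v≢a
  innerRun-parity (other _ e) (x List.∷ y List.∷ u) m eq _ u≢a v≢a with _ , eq′ ← ∷-injective eq =
    innerRun-parity e (y List.∷ u) m eq′ (λ ()) u≢a v≢a

  evenRunsAfter⇒evenRuns : ∀ {n} {w : Vec A n} → EvenRunsAfter a false w → EvenRuns a w
  evenRunsAfter⇒evenRuns e u m v eq u≢a v≢a =
    odd≡false⇒2∣ m (innerRun-parity e u m eq (λ _ → refl) u≢a v≢a)

  replicate-∷ : ∀ k (w : List A) → List.replicate k a List.++ a List.∷ w ≡
                List.replicate (suc k) a List.++ w
  replicate-∷ zero    w = refl
  replicate-∷ (suc k) w = cong (a List.∷_) (replicate-∷ k w)

  last-replicate-++ : ∀ k {b} → b ≢ a → ∀ u → List.last u ≢ just a →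
              List.last (List.replicate k a List.++ b List.∷ u) ≢ just a
  last-replicate-++ zero          b≢a List.[]      u≢a = b≢a ∘ just-injective
  last-replicate-++ zero          b≢a (_ List.∷ _) u≢a = u≢a
  last-replicate-++ (suc zero)    b≢a u            u≢a = last-replicate-++ zero b≢a u u≢a
  last-replicate-++ (suc (suc k)) b≢a u            u≢a = last-replicate-++ (suc k) b≢a u u≢a

  evenRuns⇒evenRunsAfter : DecidableEquality A → ∀ {n} {w : Vec A n} →
                           EvenRuns a w → EvenRunsAfter a false w
  evenRuns⇒evenRunsAfter _≟ᴬ_ {w = w} = go 0 w
    where
    EvenRunsᴸ : List A → Set
    EvenRunsᴸ w = ∀ u m v → w ≡ u List.++ List.replicate m a List.++ v →
                  List.last u ≢ just a → List.head v ≢ just a → 2 ∣ m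

    -- The prefix up to `b` moves into `u`; even when `u` is empty, the longer word does not end
    -- with `a`.
    dropRun : ∀ k {b w} → b ≢ a → EvenRunsᴸ (List.replicate k a List.++ b List.∷ w) → EvenRunsᴸ w
    dropRun k {b} b≢a h u m v refl u≢a v≢a =
      h (List.replicate k a List.++ b List.∷ u) m v (sym (++-assoc (List.replicate k a) (b List.∷ u) _))
        (last-replicate-++ k b≢a u u≢a) v≢a

    -- The `k` letters `a` just read stay in the hypothesis, since a run crossing the current
    -- position is visible only there. Where the run ends, the choice of empty `u` and `m = k` shows
    -- that `k` is even.
    go : ∀ k {n} (w : Vec A n) → EvenRunsᴸ (List.replicate k a List.++ toList w) →
         EvenRunsAfter a (odd k) w
    go k [] h =
      subst (λ c → EvenRunsAfter a c []) (sym (2∣⇒odd≡false (h List.[] k List.[] refl (λ ()) λ ()))) []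
    go k (b ∷ w) h with b ≟ᴬ a
    ... | yes refl = run (go (suc k) w (subst EvenRunsᴸ (replicate-∷ k (toList w)) h))
    ... | no b≢a   =
      subst (λ c → EvenRunsAfter a c (b ∷ w))
            (sym (2∣⇒odd≡false (h List.[] k (toList (b ∷ w)) refl (λ ()) (b≢a ∘ just-injective))))
            (other b≢a (go 0 w (dropRun k b≢a h)))

-- Fibonacci cubes

replace⇒adjacent : ∀ {n} {u v : Vec Bool n} → Replace (false ∷ []) (true ∷ []) u v → Adj (Hypercube n) u v
replace⇒adjacent (here v) =
  zero , (λ ()) , λ { {zero} _ → refl ; {suc j} d → contradiction refl d }
replace⇒adjacent (there a r) with i , d , unique ← replace⇒adjacent r =
  suc i , d , λ { {zero} d′ → contradiction refl d′ ; {suc j} d′ → cong suc (unique d′) }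

adjacent⇒replace : ∀ {n} (u v : Vec Bool n) → Adj (Hypercube n) u v →
                   SymClosure (Replace (false ∷ []) (true ∷ [])) u v
adjacent⇒replace (x ∷ u) (y ∷ v) (zero , d , unique)
  -- Uniqueness only refutes a difference at `suc j`; decidable equality of bits turns this into
  -- agreement of the tails.
  with refl ← Pointwise-≡⇒≡ {xs = u} {ys = v}
                (ext λ j → decidable-stable (lookup u j Bool.≟ lookup v j)
                             λ d′ → contradiction (unique {suc j} d′) λ ())
  with x | y
... | false | false = contradiction refl d
... | false | true  = fwd (here u)
... | true  | false = bwd (here u)
... | true  | true  = contradiction refl d
adjacent⇒replace (x ∷ u) (y ∷ v) (suc i , d , unique)
  with refl ← decidable-stable (x Bool.≟ y) (λ d′ → contradiction (unique {zero} d′) λ ())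
  = gmap (x ∷_) (there x) (adjacent⇒replace u v (i , d , λ d′ → suc-injective (unique d′)))

-- This is addition mod 2. The automaton rejects `0F` in state `true`; staying in `true` instead
-- makes each `next c` a bijection, so that `states` takes partial sums and `letters` takes
-- successive differences.
next : Bool → Fin 2 → Bool
next c 0F = c
next c 1F = not c

letter : Bool → Fin 2
letter false = 0F
letter true  = 1F

states : ∀ {m} → Bool → Vec (Fin 2) (suc m) → Vec Bool m
states c (x ∷ [])    = []
states c (x ∷ y ∷ s) = next c x ∷ states (next c x) (y ∷ s)

-- The last letter leads from the last recorded state to the final state `false`, which `states`
-- leaves out.
letters : ∀ {m} → Bool → Vec Bool m → Vec (Fin 2) (suc m)
letters c []      = letter c ∷ []
letters c (b ∷ t) = letter (c xor b) ∷ letters b t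

next-letter : ∀ c b → next c (letter (c xor b)) ≡ b
next-letter false false = refl
next-letter false true  = refl
next-letter true  false = refl
next-letter true  true  = refl

states-letters : ∀ {m} c (t : Vec Bool m) → states c (letters c t) ≡ t
states-letters c [] = refl
states-letters c (b ∷ []) = cong (_∷ []) (next-letter c b)
states-letters c (b ∷ b′ ∷ t) =
  trans (cong (λ x → x ∷ states x (letters b (b′ ∷ t))) (next-letter c b))
        (cong (b ∷_) (states-letters b (b′ ∷ t)))

-- Every letter but the last is the sum of the states around it. Acceptance forces the last one:
-- `1F` in state `true`, `0F` in state `false`.
letters-states : ∀ {m} {c} {s : Vec (Fin 2) (suc m)} → EvenRunsAfter 1F c s →
                 letters c (states c s) ≡ s
letters-states {c = true}  (run [])                = refl
letters-states             (other {0F} _ [])       = refl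
letters-states             (other {1F} 1≢1 _)      = contradiction refl 1≢1
letters-states {c = true}  {_ ∷ _ ∷ _} (run e)     = cong (1F ∷_) (letters-states e)
letters-states {c = false} {_ ∷ _ ∷ _} (run e)     = cong (1F ∷_) (letters-states e)
letters-states {s = _ ∷ _ ∷ _} (other {0F} _ e)    = cong (0F ∷_) (letters-states e)

-- In state `true` only `1F` is accepted, and it leads to `false`. The initial state stands in front
-- so that the induction also covers the pair it forms with the first recorded state.
states-sparse : ∀ {m} {c} {s : Vec (Fin 2) (suc m)} → EvenRunsAfter 1F c s →
                NoConsecutive1s (c ∷ states c s)
states-sparse {s = _ ∷ []} _                      = [-]
states-sparse {c = true}  {_ ∷ _ ∷ _} (run e)     = (λ ()) ∷ states-sparse e
states-sparse {c = false} {_ ∷ _ ∷ _} (run e)     = (λ ()) ∷ states-sparse e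
states-sparse {s = _ ∷ _ ∷ _} (other {0F} _ e)    = (λ ()) ∷ states-sparse e
states-sparse {s = _ ∷ _ ∷ _} (other {1F} 1≢1 e)  = contradiction refl 1≢1

letters-evenRuns : ∀ {m} c (t : Vec Bool m) → NoConsecutive1s (c ∷ t) →
                   EvenRunsAfter 1F c (letters c t)
letters-evenRuns false []          _       = other (λ ()) []
letters-evenRuns true  []          _       = run []
letters-evenRuns false (false ∷ t) (_ ∷ l) = other (λ ()) (letters-evenRuns false t l)
letters-evenRuns false (true ∷ t)  (_ ∷ l) = run (letters-evenRuns true t l)
letters-evenRuns true  (false ∷ t) (_ ∷ l) = run (letters-evenRuns false t l)
letters-evenRuns true  (true ∷ t)  (r ∷ l) = contradiction (refl , refl) r

false∷-sparse : ∀ {m} (t : Vec Bool m) → NoConsecutive1s t → NoConsecutive1s (false ∷ t)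
false∷-sparse []      _ = [-]
false∷-sparse (b ∷ t) l = (λ ()) ∷ l

-- Acceptance forces state `false` in front of `00`. Both `00` and `11` lead from there back to
-- `false`, so only the state between the two letters changes.
states-replace : ∀ {m} {c} {s t : Vec (Fin 2) (suc m)} → EvenRunsAfter 1F c s →
                 Replace (0F ∷ 0F ∷ []) (1F ∷ 1F ∷ []) s t →
                 Replace (false ∷ []) (true ∷ []) (states c s) (states c t)
states-replace (other _ _) (here [])      = here []
states-replace (other _ _) (here (x ∷ v)) = here (states false (0F ∷ x ∷ v))
states-replace {s = _ ∷ _ ∷ _} {_ ∷ _ ∷ _} (run e) (there _ r)          = there _ (states-replace e r)
states-replace {s = _ ∷ _ ∷ _} {_ ∷ _ ∷ _} (other {0F} _ e) (there _ r) = there _ (states-replace e r)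
states-replace (other {1F} 1≢1 _) (there _ _) = contradiction refl 1≢1

-- A bit enters only two letters, its sums with its neighbours. Sparsity of `v` makes both
-- neighbours of the flipped bit `false`, so these letters change from `00` to `11`; a missing right
-- neighbour counts as `false`.
letters-replace : ∀ {m} {c} {u v : Vec Bool m} → NoConsecutive1s (c ∷ v) →
                  Replace (false ∷ []) (true ∷ []) u v →
                  Replace (0F ∷ 0F ∷ []) (1F ∷ 1F ∷ []) (letters c u) (letters c v)
letters-replace {c = true}  (r ∷ _)     (here _)           = contradiction (refl , refl) r
letters-replace {c = false} _           (here [])          = here []
letters-replace {c = false} _           (here (false ∷ w)) = here (letters false w)
letters-replace {c = false} (_ ∷ r ∷ _) (here (true ∷ w))  = contradiction (refl , refl) r
letters-replace (_ ∷ l) (there b r) = there _ (letters-replace l r)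

munarini₁≅fibonacci : ∀ m → Munarini (suc m) 1 ≅ FibonacciCube m
munarini₁≅fibonacci m = record
  { bijection = mk↔ₛ′ to from
      (λ { (t , _) → value-injective (states-letters false t) })
      (λ s → value-injective (letters-states (evenRuns s)))
  ; adjacency = λ s t → mk⇔ (to-adjacent s t) (from-adjacent s t)
  }
  where
  M = Munarini (suc m) 1
  Γ = FibonacciCube m

  evenRuns : (s : Vertex M) → EvenRunsAfter 1F false (value s)
  evenRuns (s , [ p ]) =
    recompute (evenRunsAfter? _≟_ false s) (evenRuns⇒evenRunsAfter _≟_ p)

  to : Vertex M → Vertex Γ
  to (s , [ p ]) =
    -- `Linked.tail` removes the initial state `false` again.
    states false s , [ Linked.tail (states-sparse (evenRuns⇒evenRunsAfter _≟_ p)) ]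

  from : Vertex Γ → Vertex M
  from (t , [ l ]) =
    letters false t , [ evenRunsAfter⇒evenRuns (letters-evenRuns false t (false∷-sparse t l)) ]

  step⇒replace : ∀ {s t : Vec (Fin 2) (suc m)} → MunariniStep 1 s t →
                 Replace (0F ∷ 0F ∷ []) (1F ∷ 1F ∷ []) s t
  -- For `k = 1` no letter differs from both `0` and `k`, so only `00→kk` survives.
  step⇒replace (0→i 0F i≢0 _ _) = contradiction refl i≢0
  step⇒replace (0→i 1F _ i≢k _) = contradiction refl i≢k
  step⇒replace (00→kk r)        = r

  to-adjacent : ∀ s t → Adj M s t → Adj Γ (to s) (to t)
  to-adjacent s t (fwd r) =
    replace⇒adjacent (states-replace (evenRuns s) (step⇒replace r))
  to-adjacent s t (bwd r) =
    adj-sym Γ {to t} {to s} (replace⇒adjacent (states-replace (evenRuns t) (step⇒replace r)))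

  from-replace : ∀ s t → Replace (false ∷ []) (true ∷ []) (value (to s)) (value (to t)) →
                 MunariniStep 1 (value s) (value t)
  from-replace s t r = 00→kk
    (subst₂ (Replace _ _) (letters-states (evenRuns s)) (letters-states (evenRuns t))
      (letters-replace (states-sparse (evenRuns t)) r))

  from-adjacent : ∀ s t → Adj Γ (to s) (to t) → Adj M s t
  from-adjacent s t adj with adjacent⇒replace _ _ adj
  ... | fwd r = fwd (from-replace s t r)
  ... | bwd r = bwd (from-replace t s r)

-- Pell graphs

swap01 : Fin 3 → Fin 3
swap01 0F = 1F
swap01 1F = 0F
swap01 2F = 2F

swap01-involutive : ∀ x → swap01 (swap01 x) ≡ x
swap01-involutive 0F = refl
swap01-involutive 1F = refl
swap01-involutive 2F = refl

map-swap01-involutive : ∀ {n} (w : Vec (Fin 3) n) → map swap01 (map swap01 w) ≡ w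
map-swap01-involutive w =
  trans (sym (map-∘ swap01 swap01 w)) (trans (map-cong swap01-involutive w) (map-id w))

-- The exchange fixes `2F` and sends no other letter to it, so the runs of `2F` stay in place.
swap01-pellString : ∀ {n} {w : Vec (Fin 3) n} → PellString 2 w → PellString 2 (map swap01 w)
swap01-pellString =
  evenRunsAfter⇒evenRuns ∘ evenRunsAfter-map refl (λ { {2F} _ → refl }) ∘ evenRuns⇒evenRunsAfter _≟_

map-replace : ∀ {A B : Set} (f : A → B) {p n} {x y : Vec A p} {s t : Vec A n} →
              Replace x y s t → Replace (map f x) (map f y) (map f s) (map f t)
map-replace f {x = x} {y} (here v) =
  subst₂ (Replace _ _) (sym (map-++ f x v)) (sym (map-++ f y v)) (here (map f v))
map-replace f (there a r) = there (f a) (map-replace f r)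

replace-sym : ∀ {A : Set} {p n} {x y : Vec A p} {s t : Vec A n} → Replace x y s t → Replace y x t s
replace-sym (here v)    = here v
replace-sym (there a r) = there a (replace-sym r)

munarini₂≅pell : ∀ n → Munarini n 2 ≅ PellGraph n
munarini₂≅pell n = record
  { bijection = mk↔ₛ′ swap swap involutive involutive
  ; adjacency = λ s t → mk⇔ (to-adjacent s t) (from-adjacent s t)
  }
  where
  M = Munarini n 2
  Π = PellGraph n

  swap : Vertex M → Vertex Π
  swap (w , [ p ]) = map swap01 w , [ swap01-pellString p ]

  involutive : ∀ w → swap (swap w) ≡ w
  involutive (w , _) = value-injective (map-swap01-involutive w)

  step : ∀ {s t : Vec (Fin 3) n} → MunariniStep 2 s t →
         SymClosure PellStep (map swap01 s) (map swap01 t)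
  -- For `k = 2` the letter `i` can only be `1F`.
  step (0→i 0F i≢0 _ _) = contradiction refl i≢0
  step (0→i 1F _ _ r)   = bwd (0→1 (replace-sym (map-replace swap01 r)))
  step (0→i 2F _ i≢k _) = contradiction refl i≢k
  step (00→kk r)        = fwd (11→22 (map-replace swap01 r))

  unstep : ∀ {s t : Vec (Fin 3) n} → PellStep s t →
           SymClosure (MunariniStep 2) (map swap01 s) (map swap01 t)
  unstep (0→1 r)   = bwd (0→i 1F (λ ()) (λ ()) (replace-sym (map-replace swap01 r)))
  unstep (11→22 r) = fwd (00→kk (map-replace swap01 r))

  to-adjacent : ∀ s t → Adj M s t → Adj Π (swap s) (swap t)
  to-adjacent s t (fwd r) = step r
  to-adjacent s t (bwd r) = adj-sym Π {swap t} {swap s} (step r)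

  from-adjacent : ∀ s t → Adj Π (swap s) (swap t) → Adj M s t
  from-adjacent s t adj =
    -- `unswap` exchanges the letters a second time, which gives an edge between the twice exchanged
    -- words; these are the original ones.
    subst₂ (SymClosure (MunariniStep 2)) (map-swap01-involutive (value s)) (map-swap01-involutive (value t))
      (unswap adj)
    where
    unswap : ∀ {u v} → SymClosure PellStep u v → SymClosure (MunariniStep 2) (map swap01 u) (map swap01 v)
    unswap (fwd r) = unstep r
    unswap (bwd r) = adj-sym (symGraph _ _ (munariniStep-irrefl 2)) (unstep r)

proposition2p4 : (n : ℕ) → n ≥ 1 → (Munarini n 1 ≅ FibonacciCube (n ∸ 1)) × (Munarini n 2 ≅ PellGraph n)
proposition2p4 (suc m) _ = munarini₁≅fibonacci m , munarini₂≅pell (suc m)
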